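{- Let $F=\breve F(\alpha_1,\dots,\alpha_t)$ be a fence, let $i\in[t]$ with $\alpha_i\ge2$, let $v$ be the valley of $S_i$ (if it exists) and $p$ the peak of $S_i$ (if it exists). Then for each $j\in[\beta_i]$, as functions on $\mathcal J(F)$, \[ \alpha_i\hat\chi_{(i,j)}-j\hat\chi_p-(\alpha_i-j)\hat\chi_v=\mathbf 1(S_i\text{ has no valley})(\alpha_i-j)-(\alpha_i-j)\!\!\sum_{s_{(i,1)}\trianglelefteq u\trianglelefteq s_{(i,j)}}\!\!\#[s_{(i,1)},u]\,T_u-j\!\!\sum_{s_{(i,j)}\vartriangleleft u\trianglelefteq s_{(i,\beta_i)}}\!\!\#[u,s_{(i,\beta_i)}]\,T_u, \] where $[a,b]$ denotes an interval of $F$ and $\mathbf 1(\cdot)$ is $1$ if the statement holds and $0$ otherwise.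
   Context: Fences: let $\alpha=(\alpha_1,\dots,\alpha_t)$ be positive integers with $t\ge2$ and $\alpha_1,\alpha_t\ge2$. Put $a_0=0$, $a_i=\alpha_1+\dots+\alpha_i$, $n=a_t-1$. The fence $\breve F(\alpha)$ is the poset (order $\trianglelefteq$) on $\{x_1,\dots,x_n\}$ whose cover relations are: for $1\le j\le n-1$ with $a_{i-1}\le j<a_i$, $x_j\lessdot x_{j+1}$ if $i$ is odd and $x_j\gtrdot x_{j+1}$ if $i$ is even. Segments: $S_1=\{x_j:1\le j\le a_1\}$, $S_i=\{x_j:a_{i-1}\le j\le a_i\}$ for $2\le i\le t-1$, $S_t=\{x_j:a_{t-1}\le j\le n\}$ (each a chain). Shared elements $x_{a_i}$, $i\in[t-1]$, are peaks (cover two elements) for $i$ odd and valleys (covered by two elements) for $i$ even; the peak (valley) of $S_i$ is the shared element of $S_i$ that is a peak (valley), if any. $\breve S_i$ is the set of non-shared elements of $S_i$, $\beta_i=\#\breve S_i=\alpha_i-1$, $s_{(i,j)}$ is the $j$-th smallest element of $\breve S_i$. For $q\in F$ and an order ideal $I\in\mathcal J(F)$: $\hat\chi_q(I)=1$ if $q\in I$, else $0$; $T_q(I)=1$ if $q\in\min(F\setminus I)$, $-1$ if $q\in\max(I)$, $0$ otherwise. Write $\hat\chi_{(i,j)}=\hat\chi_{s_{(i,j)}}$. Convention: statistics indexed by nonexistent elements are identically zero. -}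

module Defs where

open import Algebra.Properties.CommutativeMonoid.Sum using (sum)
open import Algebra.Properties.AbelianGroup using (∙-cancelˡ; xyx⁻¹≈y)
open import Data.Bool using (if_then_else_)
open import Data.Empty using (⊥; ⊥-elim)
open import Data.Fin as Fin using (Fin; zero; suc; toℕ; inject₁)
import Data.Fin.Properties as Fin
open import Data.Fin.Subset using (Subset; _∈_; _∉_)
open import Data.Fin.Subset.Properties using (_∈?_)
open import Data.Integer as ℤ using (ℤ; +_; 0ℤ; 1ℤ; -1ℤ)
import Data.Integer.Properties as ℤ
open import Data.Maybe as Maybe using (Maybe; maybe)
open import Data.Nat
import Data.Nat.Properties as ℕ
open import Data.Parity using (0ℙ; 1ℙ)
import Data.Parity.Properties as ℙ
open import Data.Product using (∃; _×_; _,_; proj₁; proj₂)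
open import Data.Vec using (count; allFin)
open import Data.Vec.Functional using (Vector)
open import Function using (_∘_; _⇔_; mk⇔)
open import Level using (0ℓ)
open import Relation.Binary using (Rel; IsDecPartialOrder; tri<; tri≈; tri>)
import Relation.Binary as B
import Relation.Binary.Construct.NonStrictToStrict as NonStrictToStrict
open import Relation.Binary.Construct.Closure.ReflexiveTransitive using (Star; ε; _◅_; _◅◅_)
open import Relation.Binary.PropositionalEquality
open import Relation.Nullary
open import Relation.Nullary.Decidable using (map′; dec⇒maybe)
open import Relation.Unary using (Pred; Decidable)

#_ : ∀ {m} {P : Pred (Fin m) 0ℓ} → Decidable P → ℕ
#_ {m} P? = count P? (allFin m)

𝟏 : {A : Set} → Dec A → ℤ
𝟏 A? = if does A? then 1ℤ else 0ℤ

∑∈ : ∀ {m} {P : Pred (Fin m) 0ℓ} → Decidable P → (Fin m → ℤ) → ℤ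
∑∈ P? f = sum ℤ.+-0-commutativeMonoid (λ u → if does (P? u) then f u else 0ℤ)

partialSum : ∀ {t} → Vector ℕ t → Fin (suc t) → ℕ
partialSum         α zero    = 0
partialSum {suc t} α (suc k) = α zero + partialSum (α ∘ suc) k

partialSum-mono : ∀ {t} (α : Vector ℕ t) {k l} → k Fin.≤ l → partialSum α k ≤ partialSum α l
partialSum-mono         α {zero}          _         = z≤n
partialSum-mono {suc t} α {suc k} {suc l} (s≤s k≤l) =
  ℕ.+-monoʳ-≤ (α zero) (partialSum-mono (α ∘ suc) k≤l)

-- The definitions make sense for every α : Vector ℕ t; the standing
-- assumptions on α (t ≥ 2, positive entries, first and last entry ≥ 2) are
-- hypotheses of the theorem.
module Fence {t : ℕ} (α : Vector ℕ t) where

  a : Fin (suc t) → ℕ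
  a = partialSum α

  -- The index i ∈ [t] of a segment is represented by i : Fin t with
  -- toℕ i = i - 1, so aₗ i is a_{i-1} and aᵣ i is a_i.
  aₗ aᵣ : Fin t → ℕ
  aₗ i = a (inject₁ i)
  aᵣ i = a (suc i)

  Odd Even : Pred (Fin t) 0ℓ
  Odd  i = parity (suc (toℕ i)) ≡ 1ℙ
  Even i = parity (suc (toℕ i)) ≡ 0ℙ

  n : ℕ
  n = a (Fin.fromℕ t) ∸ 1

  -- x : Fin n stands for x_j with j = pos x.
  pos : Fin n → ℕ
  pos x = suc (toℕ x)

  data _⋖_ (x y : Fin n) : Set where
    up   : ∀ i → Odd i  → aₗ i ≤ pos x → pos x < aᵣ i → pos y ≡ suc (pos x) → x ⋖ y
    down : ∀ i → Even i → aₗ i ≤ pos y → pos y < aᵣ i → pos x ≡ suc (pos y) → x ⋖ y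

  infix 4 _⋖_ _⊴_

  _⊴_ : Rel (Fin n) 0ℓ
  _⊴_ = Star _⋖_

  open NonStrictToStrict _≡_ _⊴_ public using () renaming (_<_ to infix 4 _⊲_)

  Step : Pred (Fin t) 0ℓ → ℕ → Set
  Step P k = ∃ λ i → P i × aₗ i ≤ k × k < aᵣ i

  odd? : Decidable Odd
  odd? i = parity (suc (toℕ i)) ℙ.≟ 1ℙ

  even? : Decidable Even
  even? i = parity (suc (toℕ i)) ℙ.≟ 0ℙ

  step? : ∀ {P} → Decidable P → Decidable (Step P)
  step? P? k = Fin.any? λ i → P? i ×-dec aₗ i ≤? k ×-dec k <? aᵣ i

  segment-unique : ∀ {i i′ k} → aₗ i ≤ k → k < aᵣ i → aₗ i′ ≤ k → k < aᵣ i′ → i ≡ i′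
  segment-unique {i} {i′} l r l′ r′ with Fin.<-cmp i i′
  ... | tri≈ _ i≡i′ _ = i≡i′
  ... | tri< i<i′ _ _ = ⊥-elim (ℕ.<-irrefl refl (ℕ.<-≤-trans r (ℕ.≤-trans
          (partialSum-mono α (subst (suc (toℕ i) ≤_) (sym (Fin.toℕ-inject₁ i′)) i<i′)) l′)))
  ... | tri> _ _ i′<i = ⊥-elim (ℕ.<-irrefl refl (ℕ.<-≤-trans r′ (ℕ.≤-trans
          (partialSum-mono α (subst (suc (toℕ i′) ≤_) (sym (Fin.toℕ-inject₁ i)) i′<i)) l)))

  odd-even-⊥ : ∀ {k} → Step Odd k → Step Even k → ⊥
  odd-even-⊥ (i , o , l , r) (i′ , e , l′ , r′) with segment-unique {i} {i′} l r l′ r′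
  ... | refl with trans (sym o) e
  ... | ()

  -- A rank function on positions: +1 along ascending steps, -1 along the others.
  h : ℕ → ℤ
  h zero    = 0ℤ
  h (suc k) = if does (step? odd? k) then ℤ.suc (h k) else ℤ.pred (h k)

  h-up : ∀ {k} → Step Odd k → h (suc k) ≡ ℤ.suc (h k)
  h-up {k} s with step? odd? k
  ... | yes _ = refl
  ... | no ¬s = contradiction s ¬s

  h-down : ∀ {k} → Step Even k → h k ≡ ℤ.suc (h (suc k))
  h-down {k} s with step? odd? k
  ... | yes s′ = ⊥-elim (odd-even-⊥ s′ s)
  ... | no _   = sym (ℤ.suc-pred (h k))

  h-⋖ : ∀ {x y} → x ⋖ y → h (pos y) ≡ ℤ.suc (h (pos x))
  h-⋖ (up i o l r eq)   = trans (cong h eq) (h-up (i , o , l , r))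
  h-⋖ (down i e l r eq) = trans (h-down (i , e , l , r)) (cong (ℤ.suc ∘ h) (sym eq))

  suc-+ : ∀ z k → ℤ.suc z ℤ.+ + k ≡ z ℤ.+ + suc k
  suc-+ z k = trans (cong (ℤ._+ + k) (ℤ.+-comm 1ℤ z)) (ℤ.+-assoc z 1ℤ (+ k))

  h-⊴ : ∀ {x y} → x ⊴ y → ∃ λ k → h (pos y) ≡ h (pos x) ℤ.+ + k
  h-⊴ {x} ε = 0 , sym (ℤ.+-identityʳ (h (pos x)))
  h-⊴ {x} (x⋖z ◅ z⊴y) with h-⊴ z⊴y
  ... | k , eq = suc k , trans eq (trans (cong (ℤ._+ + k) (h-⋖ x⋖z)) (suc-+ (h (pos x)) k))

  +-cancel : ∀ z {k l} → z ℤ.+ + k ≡ z ℤ.+ + l → k ≡ l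
  +-cancel z eq = ℤ.+-injective (∙-cancelˡ ℤ.+-0-abelianGroup z _ _ eq)

  ⊴-0 : ∀ {x y} → x ⊴ y → h (pos y) ≡ h (pos x) ℤ.+ + 0 → x ≡ y
  ⊴-0 ε _ = refl
  ⊴-0 {x} p@(x⋖z ◅ z⊴y) eq with h-⊴ z⊴y
  ... | k , eq′ with +-cancel (h (pos x)) {0} {suc k} (trans (sym eq)
                       (trans eq′ (trans (cong (ℤ._+ + k) (h-⋖ x⋖z)) (suc-+ (h (pos x)) k))))
  ...   | ()

  ⊴-suc : ∀ {x y k} → x ⊴ y → h (pos y) ≡ h (pos x) ℤ.+ + suc k → ∃ λ z → x ⋖ z × z ⊴ y
  ⊴-suc {x} ε eq with +-cancel (h (pos x)) {0} (trans (ℤ.+-identityʳ _) eq)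
  ... | ()
  ⊴-suc (x⋖z ◅ z⊴y) _ = _ , x⋖z , z⊴y

  h-next : ∀ {x y z k} → x ⋖ z → h (pos y) ≡ h (pos x) ℤ.+ + suc k → h (pos y) ≡ h (pos z) ℤ.+ + k
  h-next {x} {k = k} x⋖z eq =
    trans eq (sym (trans (cong (ℤ._+ + k) (h-⋖ x⋖z)) (suc-+ (h (pos x)) k)))

  _⋖?_ : B.Decidable _⋖_
  x ⋖? y with suc (pos x) ≟ pos y
  ... | yes eq = map′ (λ (i , o , l , r) → up i o l r (sym eq)) from (step? odd? (pos x))
    where
    from : x ⋖ y → Step Odd (pos x)
    from (up i o l r _) = i , o , l , r
    from (down _ _ _ _ eq′) = ⊥-elim (ℕ.<-irrefl (trans eq′ (cong suc (sym eq))) (ℕ.m≤n⇒m≤1+n ℕ.≤-refl))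
  ... | no ≢ with suc (pos y) ≟ pos x
  ...   | yes eq = map′ (λ (i , e , l , r) → down i e l r (sym eq)) from (step? even? (pos y))
    where
    from : x ⋖ y → Step Even (pos y)
    from (up _ _ _ _ eq′) = ⊥-elim (≢ (sym eq′))
    from (down i e l r _) = i , e , l , r
  ...   | no ≢′ = no λ where
    (up _ _ _ _ eq)   → ≢ (sym eq)
    (down _ _ _ _ eq) → ≢′ (sym eq)

  reach? : ∀ k x y → h (pos y) ≡ h (pos x) ℤ.+ + k → Dec (x ⊴ y)
  reach? zero x y eq = map′ (λ { refl → ε }) (λ p → ⊴-0 p eq) (x Fin.≟ y)
  reach? (suc k) x y eq =
    map′ (λ (_ , x⋖z , z⊴y) → x⋖z ◅ z⊴y) (λ p → ⊴-suc p eq) (Fin.any? next?)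
    where
    next? : Decidable (λ z → x ⋖ z × z ⊴ y)
    next? z with x ⋖? z
    ... | no ¬x⋖z = no (¬x⋖z ∘ proj₁)
    ... | yes x⋖z = map′ (x⋖z ,_) proj₂ (reach? k z y (h-next x⋖z eq))

  _⊴?_ : B.Decidable _⊴_
  x ⊴? y with h (pos y) ℤ.≟ h (pos x) ℤ.+ + ℤ.∣ h (pos y) ℤ.- h (pos x) ∣
  ... | yes eq = reach? _ x y eq
  ... | no ≢  = no λ p → let k , eq = h-⊴ p in ≢ (trans eq (cong (λ z → h (pos x) ℤ.+ + z)
      (sym (cong ℤ.∣_∣ (trans (cong (ℤ._- h (pos x)) eq) (xyx⁻¹≈y ℤ.+-0-abelianGroup (h (pos x)) (+ k)))))))

  ⊴-antisym : B.Antisymmetric _≡_ _⊴_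
  ⊴-antisym {x} {y} p q with h-⊴ p | h-⊴ q
  ... | k , eq | l , eq′ = ⊴-0 p (trans eq (cong (λ m → h (pos x) ℤ.+ + m) k≡0))
    where
    k+l≡0 : k + l ≡ 0
    k+l≡0 = +-cancel (h (pos x)) (trans (sym (ℤ.+-assoc (h (pos x)) (+ k) (+ l)))
      (trans (cong (ℤ._+ + l) (sym eq)) (trans (sym eq′) (sym (ℤ.+-identityʳ _)))))
    k≡0 : k ≡ 0
    k≡0 = ℕ.m+n≡0⇒m≡0 k k+l≡0

  ⊴-isDecPartialOrder : IsDecPartialOrder _≡_ _⊴_
  ⊴-isDecPartialOrder = record
    { isPartialOrder = record
      { isPreorder = record
        { isEquivalence = isEquivalence
        ; reflexive     = λ { refl → ε }
        ; trans         = _◅◅_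
        }
      ; antisym = ⊴-antisym
      }
    ; _≟_  = Fin._≟_
    ; _≤?_ = _⊴?_
    }

  _⊲?_ : B.Decidable _⊲_
  _⊲?_ = NonStrictToStrict.<-decidable _≡_ _⊴_ Fin._≟_ _⊴?_

  ⋖⇔cover : ∀ {x y} → x ⋖ y ⇔ (x ⊲ y × ¬ ∃ λ z → x ⊲ z × z ⊲ y)
  ⋖⇔cover {x} {y} = mk⇔ to from
    where
    h≡ : ∀ {x y} → x ⋖ y → h (pos y) ≡ h (pos x) ℤ.+ + 1
    h≡ {x} x⋖y = trans (h-⋖ x⋖y) (ℤ.+-comm 1ℤ (h (pos x)))

    ⋖⇒≢ : ∀ {x y} → x ⋖ y → x ≢ y
    ⋖⇒≢ {x} x⋖y refl with +-cancel (h (pos x)) {0} (trans (ℤ.+-identityʳ _) (h≡ x⋖y))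
    ... | ()

    to : x ⋖ y → x ⊲ y × ¬ ∃ λ z → x ⊲ z × z ⊲ y
    to x⋖y = (x⋖y ◅ ε , ⋖⇒≢ x⋖y) , λ where
      (z , (ε , ≢) , _) → ≢ refl
      (z , (x⋖w ◅ w⊴z , _) , (z⊴y , z≢y)) →
        let w≡y = ⊴-0 (w⊴z ◅◅ z⊴y) (h-next x⋖w (h≡ x⋖y))
        in z≢y (⊴-antisym z⊴y (subst (_⊴ z) w≡y w⊴z))

    from : x ⊲ y × ¬ (∃ λ z → x ⊲ z × z ⊲ y) → x ⋖ y
    from ((ε , ≢) , _) = ⊥-elim (≢ refl)
    from ((_◅_ {j = z} x⋖z z⊴y , _) , ¬between) with z Fin.≟ y
    ... | yes refl = x⋖z
    ... | no z≢y   = ⊥-elim (¬between (z , (x⋖z ◅ ε , ⋖⇒≢ x⋖z) , (z⊴y , z≢y)))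

  -- Since 1 ≤ pos x < a_t, this is also the right condition for the first and
  -- the last segment, whose ranges are cut down to 1 ≤ j and j ≤ n.
  _∈S_ : Fin n → Fin t → Set
  x ∈S i = aₗ i ≤ pos x × pos x ≤ aᵣ i

  _∈S?_ : B.Decidable _∈S_
  x ∈S? i = aₗ i ≤? pos x ×-dec pos x ≤? aᵣ i

  Shared : Pred (Fin n) 0ℓ
  Shared x = ∃ λ i → suc (toℕ i) < t × pos x ≡ aᵣ i

  shared? : Decidable Shared
  shared? x = Fin.any? λ i → suc (toℕ i) <? t ×-dec pos x ≟ aᵣ i

  IsPeak IsValley : Pred (Fin n) 0ℓ
  IsPeak   x = Shared x × ∃ λ y → ∃ λ z → y ≢ z × y ⋖ x × z ⋖ x
  IsValley x = Shared x × ∃ λ y → ∃ λ z → y ≢ z × x ⋖ y × x ⋖ z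

  isPeak? : Decidable IsPeak
  isPeak? x = shared? x ×-dec
    Fin.any? λ y → Fin.any? λ z → ¬? (y Fin.≟ z) ×-dec y ⋖? x ×-dec z ⋖? x

  isValley? : Decidable IsValley
  isValley? x = shared? x ×-dec
    Fin.any? λ y → Fin.any? λ z → ¬? (y Fin.≟ z) ×-dec x ⋖? y ×-dec x ⋖? z

  HasPeak HasValley : Pred (Fin t) 0ℓ
  HasPeak   i = ∃ λ x → x ∈S i × IsPeak x
  HasValley i = ∃ λ x → x ∈S i × IsValley x

  hasPeak? : Decidable HasPeak
  hasPeak? i = Fin.any? λ x → x ∈S? i ×-dec isPeak? x

  hasValley? : Decidable HasValley
  hasValley? i = Fin.any? λ x → x ∈S? i ×-dec isValley? x

  peak valley : Fin t → Maybe (Fin n)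
  peak   i = Maybe.map proj₁ (dec⇒maybe (hasPeak? i))
  valley i = Maybe.map proj₁ (dec⇒maybe (hasValley? i))

  _∈S̆_ : Fin n → Fin t → Set
  x ∈S̆ i = x ∈S i × ¬ Shared x

  _∈S̆?_ : B.Decidable _∈S̆_
  x ∈S̆? i = x ∈S? i ×-dec ¬? (shared? x)

  β : Fin t → ℕ
  β i = # (_∈S̆? i)

  -- x is s_(i,j), the j-th smallest element (counting from 1) of the chain S̆ i.
  IsS : Fin t → ℕ → Pred (Fin n) 0ℓ
  IsS i j x = x ∈S̆ i × # (λ u → u ∈S̆? i ×-dec u ⊴? x) ≡ j

  #[_,_] : Fin n → Fin n → ℕ
  #[ x , y ] = # (λ u → x ⊴? u ×-dec u ⊴? y)

  record 𝒥 : Set where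
    field
      elements : Subset n
      closed   : ∀ {x y} → x ⊴ y → y ∈ elements → x ∈ elements

  open 𝒥 public

  MaximalIn MinimalOutside : 𝒥 → Pred (Fin n) 0ℓ
  MaximalIn      I q = q ∈ elements I × (∀ u → u ∈ elements I → ¬ (q ⊲ u))
  MinimalOutside I q = q ∉ elements I × (∀ u → u ∉ elements I → ¬ (u ⊲ q))

  maximalIn? : ∀ I → Decidable (MaximalIn I)
  maximalIn? I q = q ∈? elements I ×-dec
    Fin.all? λ u → u ∈? elements I →-dec ¬? (q ⊲? u)

  minimalOutside? : ∀ I → Decidable (MinimalOutside I)
  minimalOutside? I q = ¬? (q ∈? elements I) ×-dec
    Fin.all? λ u → ¬? (u ∈? elements I) →-dec ¬? (u ⊲? q)

  χ̂ : Fin n → 𝒥 → ℤ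
  χ̂ q I = 𝟏 (q ∈? elements I)

  -- A statistic indexed by a nonexistent element is identically zero.
  χ̂? : Maybe (Fin n) → 𝒥 → ℤ
  χ̂? q I = maybe (λ q → χ̂ q I) 0ℤ q

  T : Fin n → 𝒥 → ℤ
  T q I = if does (minimalOutside? I q) then 1ℤ
          else if does (maximalIn? I q) then -1ℤ
          else 0ℤ

module Submission where

-- Fix the segment i and number its chain from below: valley 0, inner elements
-- 1, …, β i, peak α i. Let c k be the indicator of the k-th element, with
-- c 0 = 1 if there is no valley and c (α i) = 0 if there is no peak. Along the
-- chain c is non-increasing with values 0 and 1, and every order relation of an
-- inner element stays inside the chain, so T at the k-th inner element is the
-- second difference c (k - 1) - 2 c k + c (k + 1). The weights in the two sums
-- are affine in k, so both sums collapse by summation by parts to values of c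
-- at 0, j, j + 1 and α i, and the terms with c (j + 1) cancel.

open import Defs
open import Data.Fin using (Fin)
open import Data.Integer using (ℤ; +_; _+_; _-_; _*_)
open import Data.Nat as ℕ using (ℕ; _≤_)
open import Data.Vec.Functional using (Vector; head; last)
open import Relation.Binary.PropositionalEquality using (_≡_)
open import Relation.Nullary.Decidable using (¬?; _×-dec_)

open import Algebra.Properties.CommutativeMonoid.Sum
open import Data.Bool using (true; false; if_then_else_)
open import Data.Empty using (⊥-elim)
open import Data.Fin as Fin using (toℕ)
import Data.Fin.Properties as Fin
open import Data.Fin.Subset using (_∈_; _∉_)
open import Data.Fin.Subset.Properties using (_∈?_)
open import Data.Integer using (0ℤ; 1ℤ; -1ℤ)
import Data.Integer.Properties as ℤ
open import Data.Integer.Tactic.RingSolver using (solve; solve-∀)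
open import Data.List using ([]; _∷_)
open import Data.Nat using (parity; zero; suc; _<_; z≤n; s≤s)
import Data.Nat.Properties as ℕ
open import Data.Parity as ℙ using (0ℙ; 1ℙ)
import Data.Parity.Properties as ℙ
open import Data.Product using (∃; _×_; _,_; proj₁; proj₂)
open import Data.Sum using (_⊎_; inj₁; inj₂)
open import Data.Vec using (count; tabulate)
open import Function using (_∘_; id; case_of_; Equivalence)
open import Level using (0ℓ)
open import Relation.Binary using (tri<; tri≈; tri>)
open import Relation.Binary.Construct.Closure.ReflexiveTransitive using (ε; _◅_; _◅◅_)
open import Relation.Binary.PropositionalEquality
open import Relation.Nullary using (Dec; yes; no; ¬_; contradiction; does)
open import Relation.Nullary.Decidable using (dec-true; dec-false; _⊎-dec_)
open import Relation.Unary using (Pred; Decidable)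

-- Finite sums of integers and reindexing.

∑ : ∀ {m} → (Fin m → ℤ) → ℤ
∑ = sum ℤ.+-0-commutativeMonoid

∑-cong : ∀ {m} {f g : Fin m → ℤ} → (∀ k → f k ≡ g k) → ∑ f ≡ ∑ g
∑-cong = sum-cong-≗ ℤ.+-0-commutativeMonoid

∑-zero : ∀ {m} {f : Fin m → ℤ} → (∀ k → f k ≡ 0ℤ) → ∑ f ≡ 0ℤ
∑-zero {m} f≡0 = trans (∑-cong f≡0) (sum-replicate-zero ℤ.+-0-commutativeMonoid m)

∑-single : ∀ {m} (f : Fin m → ℤ) k₀ → (∀ k → k ≢ k₀ → f k ≡ 0ℤ) → ∑ f ≡ f k₀
∑-single {suc m} f k₀ f≡0 = trans (sum-remove ℤ.+-0-commutativeMonoid {i = k₀} f)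
  (trans (cong (λ z → f k₀ + z) (∑-zero (λ k → f≡0 _ (Fin.punchInᵢ≢i k₀ k)))) (ℤ.+-identityʳ (f k₀)))

if-yes : ∀ {A : Set} (A? : Dec A) {x y : ℤ} → A → (if does A? then x else y) ≡ x
if-yes A? {x} {y} a = cong (if_then x else y) (dec-true A? a)

if-no : ∀ {A : Set} (A? : Dec A) {x y : ℤ} → ¬ A → (if does A? then x else y) ≡ y
if-no A? {x} {y} ¬a = cong (if_then x else y) (dec-false A? ¬a)

-- The indicator of `P` at `u` equals the number of `k` with `e k ≡ u`, which injectivity keeps at
-- most one. Exchanging the two sums leaves a single term for each `k`.
∑∈-image : ∀ {m N} {P : Pred (Fin m) 0ℓ} (P? : Decidable P) (f : Fin m → ℤ) (e : Fin N → Fin m) →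
  (∀ {k l} → e k ≡ e l → k ≡ l) → (∀ k → P (e k)) → (∀ {u} → P u → ∃ λ k → e k ≡ u) →
  ∑∈ P? f ≡ ∑ (f ∘ e)
∑∈-image {m} {N} P? f e e-inj e∈P P⊆e = begin
  ∑∈ P? f                              ≡⟨ ∑-cong split ⟩
  ∑ (λ u → ∑ (λ k → hit u k))          ≡⟨ ∑-comm ℤ.+-0-commutativeMonoid hit ⟩
  ∑ (λ k → ∑ (λ u → hit u k))          ≡⟨ ∑-cong collapse ⟩
  ∑ (f ∘ e)                            ∎
  where
  open ≡-Reasoning
  hit : Fin m → Fin N → ℤ
  hit u k = if does (e k Fin.≟ u) then f u else 0ℤ

  split : ∀ u → (if does (P? u) then f u else 0ℤ) ≡ ∑ (hit u)
  split u with P? u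
  ... | yes p with k₀ , refl ← P⊆e p = sym (trans
          (∑-single (hit (e k₀)) k₀ (λ k k≢k₀ → if-no (e k Fin.≟ e k₀) (k≢k₀ ∘ e-inj)))
          (if-yes (e k₀ Fin.≟ e k₀) refl))
  ... | no ¬p = sym (∑-zero (λ k → if-no (e k Fin.≟ u) (λ { refl → ¬p (e∈P k) })))

  collapse : ∀ k → ∑ (λ u → hit u k) ≡ f (e k)
  collapse k = trans
    (∑-single (λ u → hit u k) (e k) (λ u u≢ek → if-no (e k Fin.≟ u) (u≢ek ∘ sym)))
    (if-yes (e k Fin.≟ e k) refl)

#-∑∈ : ∀ {m} {P : Pred (Fin m) 0ℓ} (P? : Decidable P) → + (# P?) ≡ ∑∈ P? (λ _ → 1ℤ)
#-∑∈ {m} P? = go id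
  where
  -- The induction runs over an arbitrary `e`, because the tail of `tabulate e` is
  -- `tabulate (e ∘ suc)`.
  go : ∀ {k} (e : Fin k → Fin m) → + count P? (tabulate e) ≡ ∑ (𝟏 ∘ P? ∘ e)
  go {zero}  e = refl
  go {suc k} e with does (P? (e Fin.zero))
  ... | true  = cong (λ z → 1ℤ + z) (go (e ∘ Fin.suc))
  ... | false = trans (go (e ∘ Fin.suc)) (sym (ℤ.+-identityˡ _))

∑-one : ∀ N → ∑ {N} (λ _ → 1ℤ) ≡ + N
∑-one zero    = refl
∑-one (suc N) = cong (λ z → 1ℤ + z) (∑-one N)

-- Summation by parts.

Δ² : (ℕ → ℤ) → ℕ → ℤ
Δ² c k = c k - + 2 * c (suc k) + c (suc (suc k))

-- Moving both differences onto the weight kills every interior term, since an affine weight has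
-- second difference zero. The boundary coefficients are the weights at 0 and `m - 1` and, with a
-- minus sign, the weights extrapolated to -1 and `m`; in this form the formula also holds for
-- `m = 0`.
∑-affine-Δ² : ∀ (w δ : ℤ) m (c : ℕ → ℤ) →
  ∑ {m} (λ k → (w + δ * + toℕ k) * Δ² c (toℕ k))
    ≡ w * c 0 - (w - δ) * c 1 + (w + δ * (+ m - 1ℤ)) * c (suc m) - (w + δ * + m) * c m
∑-affine-Δ² w δ zero c = base w δ (c 0) (c 1)
  where
  base : ∀ w δ x y → 0ℤ ≡ w * x - (w - δ) * y + (w + δ * (0ℤ - 1ℤ)) * y - (w + δ * 0ℤ) * x
  base = solve-∀
∑-affine-Δ² w δ (suc m) c = begin
  first + ∑ {m} (λ k → (w + δ * + suc (toℕ k)) * Δ² c (suc (toℕ k)))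
    ≡⟨ cong (λ z → first + z)
         (∑-cong {m} (λ k → cong (_* Δ² c (suc (toℕ k))) (shift w δ (+ toℕ k)))) ⟩
  first + ∑ {m} (λ k → ((w + δ) + δ * + toℕ k) * Δ² (c ∘ suc) (toℕ k))
    ≡⟨ cong (λ z → first + z) (∑-affine-Δ² (w + δ) δ m (c ∘ suc)) ⟩
  first + ((w + δ) * c 1 - (w + δ - δ) * c 2
    + (w + δ + δ * (+ m - 1ℤ)) * c (suc (suc m)) - (w + δ + δ * + m) * c (suc m))
    ≡⟨ step w δ (+ m) (c 0) (c 1) (c 2) (c (suc m)) (c (suc (suc m))) ⟩
  w * c 0 - (w - δ) * c 1 + (w + δ * (1ℤ + + m - 1ℤ)) * c (suc (suc m))
    - (w + δ * (1ℤ + + m)) * c (suc m) ∎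
  where
  open ≡-Reasoning
  first = (w + δ * 0ℤ) * Δ² c 0
  shift : ∀ w δ k → w + δ * (1ℤ + k) ≡ (w + δ) + δ * k
  shift = solve-∀
  step : ∀ w δ m c₀ c₁ c₂ x y →
    (w + δ * 0ℤ) * (c₀ - + 2 * c₁ + c₂)
      + ((w + δ) * c₁ - (w + δ - δ) * c₂ + (w + δ + δ * (m - 1ℤ)) * y - (w + δ + δ * m) * x)
    ≡ w * c₀ - (w - δ) * c₁ + (w + δ * (1ℤ + m - 1ℤ)) * y - (w + δ * (1ℤ + m)) * x
  step = solve-∀

-- The statistic T in terms of covers.

module _ {t : ℕ} {α : Vector ℕ t} where
  open Fence α

  ⋖⇒⊲ : ∀ {x y} → x ⋖ y → x ⊲ y
  ⋖⇒⊲ x⋖y = proj₁ (Equivalence.to ⋖⇔cover x⋖y)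

  -- `Star` exposes the first cover of a path; testing minimality outside an ideal needs the last
  -- one.
  ⊲-lastStep : ∀ {x y} → x ⊲ y → ∃ λ w → x ⊴ w × w ⋖ y
  ⊲-lastStep (x⊴y , x≢y) = go x⊴y x≢y
    where
    go : ∀ {x y} → x ⊴ y → x ≢ y → ∃ λ w → x ⊴ w × w ⋖ y
    go ε x≢x = contradiction refl x≢x
    go {x} {y} (_◅_ {j = z} x⋖z z⊴y) _ with z Fin.≟ y
    ... | yes refl = x , ε , x⋖z
    ... | no z≢y with w , z⊴w , w⋖y ← go z⊴y z≢y = w , x⋖z ◅ z⊴w , w⋖y

  -- Anything strictly below `q` lies weakly below a lower cover of `q`, so an ideal containing all
  -- lower covers contains it too.
  minimalOutside-⋖ : ∀ I {q} → q ∉ elements I → (∀ {w} → w ⋖ q → w ∈ elements I) → MinimalOutside I q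
  minimalOutside-⋖ I q∉I lower = q∉I , λ u u∉I u⊲q →
    let w , u⊴w , w⋖q = ⊲-lastStep u⊲q in u∉I (closed I u⊴w (lower w⋖q))

  maximalIn-⋖ : ∀ I {q} → q ∈ elements I → (∀ {w} → q ⋖ w → w ∉ elements I) → MaximalIn I q
  maximalIn-⋖ I q∈I upper = q∈I , λ where
    u u∈I (ε , q≢q)         → q≢q refl
    u u∈I (q⋖w ◅ w⊴u , _)   → upper q⋖w (closed I w⊴u u∈I)

  T-minimal : ∀ I {q} → MinimalOutside I q → T q I ≡ 1ℤ
  T-minimal I {q} min = if-yes (minimalOutside? I q) min

  T-maximal : ∀ I {q} → MaximalIn I q → T q I ≡ -1ℤ
  T-maximal I {q} max@(q∈I , _) = trans
    (if-no (minimalOutside? I q) (λ (q∉I , _) → q∉I q∈I))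
    (if-yes (maximalIn? I q) max)

  T-neither : ∀ I {q} → ¬ MinimalOutside I q → ¬ MaximalIn I q → T q I ≡ 0ℤ
  T-neither I {q} ¬min ¬max = trans (if-no (minimalOutside? I q) ¬min) (if-no (maximalIn? I q) ¬max)

  -- At k x says that x is the k-th element of the chain S i counted from below,
  -- where the valley has index 0 and the peak has index α i; these two indices
  -- are vacant when S i has no valley or no peak.
  record Coordinate (i : Fin t) : Set₁ where
    field
      At              : ℕ → Pred (Fin n) 0ℓ
      At?             : ∀ k → Decidable (At k)
      at-unique       : ∀ {k x y} → At k x → At k y → x ≡ y
      at-index        : ∀ {k l x} → At k x → At l x → k ≡ l
      ∈S⇒at           : ∀ {x} → x ∈S i → ∃ λ k → k ≤ α i × At k x
      at⇒∈S           : ∀ {k x} → k ≤ α i → At k x → x ∈S i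
      inner-exists    : ∀ {k} → 0 < k → k < α i → ∃ (At k)
      inner-nonshared : ∀ {k x} → 0 < k → k < α i → At k x → ¬ Shared x
      at-valley       : ∀ {x} → At 0 x → IsValley x
      at-peak         : ∀ {x} → At (α i) x → IsPeak x
      cover           : ∀ {k x y} → k < α i → At k x → At (suc k) y → x ⋖ y
      below           : ∀ {k x w} → k < α i → At k x → w ⋖ x → ∃ λ k′ → k ≡ suc k′ × At k′ w
      above           : ∀ {k x w} → 0 < k → k ≤ α i → At k x → x ⋖ w → k < α i × At (suc k) w

  -- Order and counting along one segment.

  module _ {i : Fin t} (C : Coordinate i) (0<αᵢ : 0 < α i) where
    open Coordinate C

    at-cast : ∀ {k l x} → k ≡ l → At k x → At l x
    at-cast refl at = at

    -- At a positive index every upper cover sits at the next index, so two distinct upper covers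
    -- force index 0. Dually, `peak-at` uses that below `α i` there is at most one lower cover.
    valley-at : ∀ {x} → x ∈S i → IsValley x → At 0 x
    valley-at x∈S (_ , y , z , y≢z , x⋖y , x⋖z) with ∈S⇒at x∈S
    ... | zero  , _   , at = at
    ... | suc k , k≤α , at = contradiction
      (at-unique (proj₂ (above (s≤s z≤n) k≤α at x⋖y)) (proj₂ (above (s≤s z≤n) k≤α at x⋖z))) y≢z

    peak-at : ∀ {x} → x ∈S i → IsPeak x → At (α i) x
    peak-at x∈S (_ , y , z , y≢z , y⋖x , z⋖x) with ∈S⇒at x∈S
    ... | k , k≤α , at with ℕ.m≤n⇒m<n∨m≡n k≤α
    ...   | inj₂ refl = at
    ...   | inj₁ k<α with k₁ , refl , at₁ ← below k<α at y⋖x | k₂ , refl , at₂ ← below k<α at z⋖x =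
      contradiction (at-unique at₁ at₂) y≢z

    ∈S̆⇒at : ∀ {x} → x ∈S̆ i → ∃ λ k → 0 < k × k < α i × At k x
    ∈S̆⇒at (x∈S , ¬shared) with ∈S⇒at x∈S
    ... | zero  , _   , at = contradiction (proj₁ (at-valley at)) ¬shared
    ... | suc k , k≤α , at with ℕ.m≤n⇒m<n∨m≡n k≤α
    ...   | inj₁ k<α = suc k , s≤s z≤n , k<α , at
    ...   | inj₂ k≡α = contradiction (proj₁ (at-peak (at-cast k≡α at))) ¬shared

    at⇒∈S̆ : ∀ {k x} → 0 < k → k < α i → At k x → x ∈S̆ i
    at⇒∈S̆ 0<k k<α at = at⇒∈S (ℕ.<⇒≤ k<α) at , inner-nonshared 0<k k<α at

    -- A descending path can leave the segment only from its peak, hence `q < α i`. For ascending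
    -- paths in `above*` the only exit is the valley, hence `0 < p`.
    below* : ∀ {q u y} → q < α i → At q y → u ⊴ y → ∃ λ r → r ≤ q × At r u
    below* q<α at ε = _ , ℕ.≤-refl , at
    below* q<α at (u⋖z ◅ z⊴y) with r , r≤q , at-z ← below* q<α at z⊴y
      with r′ , refl , at-u ← below (ℕ.≤-<-trans r≤q q<α) at-z u⋖z = r′ , ℕ.<⇒≤ r≤q , at-u

    above* : ∀ {p x u} → 0 < p → p ≤ α i → At p x → x ⊴ u → ∃ λ r → p ≤ r × At r u
    above* 0<p p≤α at ε = _ , ℕ.≤-refl , at
    above* 0<p p≤α at (x⋖z ◅ z⊴u) with p<α , at-z ← above 0<p p≤α at x⋖z
      with r , p<r , at-u ← above* (s≤s z≤n) p<α at-z z⊴u = r , ℕ.<⇒≤ p<r , at-u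

    at-⊴ : ∀ {p q x y} → 0 < p → p ≤ q → q < α i → At p x → At q y → x ⊴ y
    at-⊴ {p} {zero} 0<p p≤q = contradiction (ℕ.<-≤-trans 0<p p≤q) λ ()
    at-⊴ {p} {suc q} 0<p p≤q q<α at-x at-y with ℕ.m≤n⇒m<n∨m≡n p≤q
    ... | inj₂ refl = subst (_ ⊴_) (at-unique at-x at-y) ε
    ... | inj₁ (s≤s p≤q′)
      with z , at-z ← inner-exists (ℕ.<-≤-trans 0<p p≤q′) (ℕ.<⇒≤ q<α) =
      at-⊴ 0<p p≤q′ (ℕ.<⇒≤ q<α) at-x at-z ◅◅ cover (ℕ.<⇒≤ q<α) at-z at-y ◅ ε

    InRange : ℕ → ℕ → Pred (Fin n) 0ℓ
    InRange p N u = ∃ λ k → k < N × At (p ℕ.+ k) u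

    -- The bounds keep the indices from `p` to `p + N - 1` strictly between valley and peak, so each
    -- is occupied. The chosen occupants give the injective enumeration for `∑∈-image`.
    ∑∈-range : ∀ p N → 0 < p → p ℕ.+ N ≤ α i → ∀ {P : Pred (Fin n) 0ℓ} (P? : Decidable P) →
      (∀ {u} → P u → InRange p N u) → (∀ {u} → InRange p N u → P u) →
      (f : Fin n → ℤ) (g : ℕ → ℤ) → (∀ {k u} → k < N → At (p ℕ.+ k) u → f u ≡ g k) →
      ∑∈ P? f ≡ ∑ {N} (g ∘ toℕ)
    ∑∈-range p N 0<p p+N≤α P? to from f g f≡g = trans
      (∑∈-image P? f e
        (λ {k} {l} eq → Fin.toℕ-injective (ℕ.+-cancelˡ-≡ p _ _
          (at-index (e-at k) (subst (At _) (sym eq) (e-at l)))))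
        (λ k → from (toℕ k , Fin.toℕ<n k , e-at k))
        (λ Pu → let k , k<N , at = to Pu in
          Fin.fromℕ< k<N , at-unique (e-at _) (at-cast (cong (p ℕ.+_) (sym (Fin.toℕ-fromℕ< k<N))) at)))
      (∑-cong (λ k → f≡g (Fin.toℕ<n k) (e-at k)))
      where
      point : (k : Fin N) → ∃ (At (p ℕ.+ toℕ k))
      point k = inner-exists (ℕ.<-≤-trans 0<p (ℕ.m≤m+n p _))
        (ℕ.<-≤-trans (ℕ.+-monoʳ-< p (Fin.toℕ<n k)) p+N≤α)
      e : Fin N → Fin n
      e = proj₁ ∘ point
      e-at : ∀ k → At (p ℕ.+ toℕ k) (e k)
      e-at = proj₂ ∘ point

    #-range : ∀ p N → 0 < p → p ℕ.+ N ≤ α i → ∀ {P : Pred (Fin n) 0ℓ} (P? : Decidable P) →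
      (∀ {u} → P u → InRange p N u) → (∀ {u} → InRange p N u → P u) → # P? ≡ N
    #-range p N 0<p p+N≤α P? to from = ℤ.+-injective (trans (#-∑∈ P?) (trans
      (∑∈-range p N 0<p p+N≤α P? to from (λ _ → 1ℤ) (λ _ → 1ℤ) (λ _ _ → refl)) (∑-one N)))

    -- Descending from `y` bounds the index of `u` above and ascending from `x` bounds it below;
    -- `at-index` identifies the two indices.
    between⇒inRange : ∀ p N {x y u} → 0 < p → p ℕ.+ N < α i → At p x → At (p ℕ.+ N) y →
      x ⊴ u × u ⊴ y → InRange p (suc N) u
    between⇒inRange p N 0<p q<α at-x at-y (x⊴u , u⊴y)
      with r , r≤q , at-u ← below* q<α at-y u⊴y
      with r′ , p≤r′ , at-u′ ← above* 0<p (ℕ.≤-trans (ℕ.m≤m+n p N) (ℕ.<⇒≤ q<α)) at-x x⊴u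
      with refl ← at-index at-u at-u′
      with k , refl ← ℕ.m≤n⇒∃[o]m+o≡n p≤r′ = k , s≤s (ℕ.+-cancelˡ-≤ p k N r≤q) , at-u

    inRange⇒between : ∀ p N {x y u} → 0 < p → p ℕ.+ N < α i → At p x → At (p ℕ.+ N) y →
      InRange p (suc N) u → x ⊴ u × u ⊴ y
    inRange⇒between p N 0<p q<α at-x at-y (k , s≤s k≤N , at-u) =
      at-⊴ 0<p (ℕ.m≤m+n p k) (ℕ.≤-<-trans (ℕ.+-monoʳ-≤ p k≤N) q<α) at-x at-u ,
      at-⊴ (ℕ.<-≤-trans 0<p (ℕ.m≤m+n p k)) (ℕ.+-monoʳ-≤ p k≤N) q<α at-u at-y

    #interval : ∀ p N {x y} → 0 < p → p ℕ.+ N < α i → At p x → At (p ℕ.+ N) y → #[ x , y ] ≡ suc N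
    #interval p N 0<p q<α at-x at-y = #-range p (suc N) 0<p (subst (_≤ α i) (sym (ℕ.+-suc p N)) q<α) _
      (between⇒inRange p N 0<p q<α at-x at-y) (inRange⇒between p N 0<p q<α at-x at-y)

    β≡ : suc (β i) ≡ α i
    β≡ with b , 1+b≡α ← ℕ.m≤n⇒∃[o]m+o≡n 0<αᵢ = trans
      (cong suc (#-range 1 b (s≤s z≤n) (ℕ.≤-reflexive 1+b≡α) (_∈S̆? i)
      (λ u∈S̆ → case (∈S̆⇒at u∈S̆) of λ where
        (suc k , _ , k<α , at) → k , ℕ.≤-pred (subst (suc k <_) (sym 1+b≡α) k<α) , at)
      (λ (k , k<b , at) → at⇒∈S̆ (s≤s z≤n) (subst (suc k <_) 1+b≡α (s≤s k<b)) at)))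
      1+b≡α

    -- The inner elements weakly below the one at index `q` occupy the indices 1 to `q`, so rank in
    -- `S̆ i` and index agree.
    isS⇒at : ∀ {j x} → IsS i j x → j < α i × At j x
    isS⇒at {j} {x} (x∈S̆ , rank≡j) with q , 0<q , q<α , at ← ∈S̆⇒at x∈S̆ =
      subst (λ j → j < α i × At j x) q≡j (q<α , at)
      where
      q≡j : q ≡ j
      q≡j = trans (sym (#-range 1 q (s≤s z≤n) q<α (λ u → u ∈S̆? i ×-dec u ⊴? x)
        (λ (u∈S̆ , u⊴x) → case (∈S̆⇒at u∈S̆ , below* q<α at u⊴x) of λ where
          ((suc k , _ , _ , at-u) , (r , r≤q , at-u′)) → k , subst (_≤ q) (at-index at-u′ at-u) r≤q , at-u)
        (λ (k , k<q , at-u) → at⇒∈S̆ (s≤s z≤n) (ℕ.≤-<-trans k<q q<α) at-u , at-⊴ (s≤s z≤n) k<q q<α at-u at)))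
        rank≡j

    -- The trace of an ideal on the segment.

    module _ (I : 𝒥) where

      -- A missing valley counts as a bottom element that lies in every ideal,
      -- a missing peak as a top element that lies in none.
      Filled : Pred ℕ 0ℓ
      Filled k = (∃ λ u → At k u × u ∈ elements I) ⊎ (k ≡ 0 × ¬ ∃ (At 0))

      filled? : Decidable Filled
      filled? k = Fin.any? (λ u → At? k u ×-dec u ∈? elements I) ⊎-dec (k ℕ.≟ 0 ×-dec ¬? (Fin.any? (At? 0)))

      c : ℕ → ℤ
      c k = 𝟏 (filled? k)

      filled⇒∈ : ∀ {k x} → At k x → Filled k → x ∈ elements I
      filled⇒∈ at (inj₁ (u , at-u , u∈I)) = subst (_∈ elements I) (at-unique at-u at) u∈I
      filled⇒∈ at (inj₂ (refl , vacant))  = contradiction (_ , at) vacant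

      -- The ideal is closed downwards along the cover from index `k` to `suc k`; if index 0 is
      -- vacant, the convention for a missing valley fills it.
      filled-pred : ∀ {k} → k < α i → Filled (suc k) → Filled k
      filled-pred {zero} 0<α (inj₁ (u , at , u∈I)) with Fin.any? (At? 0)
      ... | yes (x , at-x) = inj₁ (x , at-x , closed I (cover 0<α at-x at ◅ ε) u∈I)
      ... | no vacant      = inj₂ (refl , vacant)
      filled-pred {suc k} k<α (inj₁ (u , at , u∈I)) with x , at-x ← inner-exists (s≤s z≤n) k<α =
        inj₁ (x , at-x , closed I (cover k<α at-x at ◅ ε) u∈I)

      c≡χ̂ : ∀ {k x} → At k x → c k ≡ χ̂ x I
      c≡χ̂ {k} {x} at with x ∈? elements I
      ... | yes x∈I = if-yes (filled? k) (inj₁ (x , at , x∈I))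
      ... | no x∉I  = if-no (filled? k) (x∉I ∘ filled⇒∈ at)

      -- Without a valley `c 0` is 1 while the statistic is 0. The subtracted indicator corrects
      -- this and becomes the term for a missing valley in the theorem.
      c-valley : χ̂? (valley i) I ≡ c 0 - 𝟏 (¬? (hasValley? i))
      c-valley with hasValley? i
      ... | yes (x , x∈S , isValley) = sym (trans (ℤ.+-identityʳ _) (c≡χ̂ (valley-at x∈S isValley)))
      ... | no ¬valley = sym (cong (_- 1ℤ) (if-yes (filled? 0)
        (inj₂ (refl , λ (x , at) → ¬valley (x , at⇒∈S z≤n at , at-valley at)))))

      c-peak : χ̂? (peak i) I ≡ c (α i)
      c-peak with hasPeak? i
      ... | yes (x , x∈S , isPeak) = sym (c≡χ̂ (peak-at x∈S isPeak))
      ... | no ¬peak = sym (if-no (filled? (α i)) λ where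
        (inj₁ (x , at , _))  → ¬peak (x , at⇒∈S ℕ.≤-refl at , at-peak at)
        -- The convention for a missing valley cannot fill the peak index, as `α i` is positive.
        (inj₂ (α≡0 , _))     → ℕ.<-irrefl (sym α≡0) 0<αᵢ)

      -- By `filled-pred` the values of `c` at `k`, `k + 1`, `k + 2` can only be 111, 110, 100 or
      -- 000. Their second differences 0, -1, 1, 0 match the cases neither, maximal, minimal,
      -- neither.
      T≡Δ²c : ∀ {k x} → suc k < α i → At (suc k) x → T x I ≡ Δ² c k
      T≡Δ²c {k} {x} k<α at = go (filled? k) (filled? (suc k)) (filled? (suc (suc k)))
        where
        values : ∀ {a b d} → c k ≡ a → c (suc k) ≡ b → c (suc (suc k)) ≡ d →
          T x I ≡ a - + 2 * b + d → T x I ≡ Δ² c k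
        values refl refl refl T≡ = T≡

        full : ∀ {l} → Filled l → c l ≡ 1ℤ
        full {l} = if-yes (filled? l)

        empty : ∀ {l} → ¬ Filled l → c l ≡ 0ℤ
        empty {l} = if-no (filled? l)

        x∈I : Filled (suc k) → x ∈ elements I
        x∈I = filled⇒∈ at

        x∉I : ¬ Filled (suc k) → x ∉ elements I
        x∉I ¬f x∈I = ¬f (inj₁ (x , at , x∈I))

        -- If an element sits at index `k`, minimality puts it in the ideal. If none does, then `k`
        -- is 0 and the valley is missing.
        minimal⇒filled : MinimalOutside I x → Filled k
        minimal⇒filled (_ , lower) with Fin.any? (At? k)
        ... | yes (w , at-w) with w ∈? elements I
        ...   | yes w∈I = inj₁ (w , at-w , w∈I)
        ...   | no w∉I  = contradiction (⋖⇒⊲ (cover (ℕ.<⇒≤ k<α) at-w at)) (lower w w∉I)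
        minimal⇒filled _ | no vacant = vacant⇒filled k<α vacant
          where
          vacant⇒filled : ∀ {k} → suc k < α i → ¬ ∃ (At k) → Filled k
          vacant⇒filled {zero}  _   vacant = inj₂ (refl , vacant)
          vacant⇒filled {suc k} k<α vacant =
            contradiction (inner-exists (s≤s z≤n) (ℕ.<⇒≤ k<α)) vacant

        go : Dec (Filled k) → Dec (Filled (suc k)) → Dec (Filled (suc (suc k))) → T x I ≡ Δ² c k
        go (yes f₀) (yes f₁) (yes f₂@(inj₁ (u , at-u , u∈I))) = values (full f₀) (full f₁) (full f₂)
          (T-neither I (λ (x∉I , _) → x∉I (x∈I f₁))
            (λ (_ , upper) → upper u u∈I (⋖⇒⊲ (cover k<α at at-u))))
        go (yes f₀) (yes f₁) (no ¬f₂) = values (full f₀) (full f₁) (empty ¬f₂)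
          (T-maximal I (maximalIn-⋖ I (x∈I f₁)
            (λ x⋖w w∈I → ¬f₂ (inj₁ (_ , proj₂ (above (s≤s z≤n) (ℕ.<⇒≤ k<α) at x⋖w) , w∈I)))))
        go (yes f₀) (no ¬f₁) (no ¬f₂) = values (full f₀) (empty ¬f₁) (empty ¬f₂)
          (T-minimal I (minimalOutside-⋖ I (x∉I ¬f₁) lower))
          where
          lower : ∀ {w} → w ⋖ x → w ∈ elements I
          lower w⋖x with _ , refl , at-w ← below k<α at w⋖x = filled⇒∈ at-w f₀
        go (no ¬f₀) (no ¬f₁) (no ¬f₂) = values (empty ¬f₀) (empty ¬f₁) (empty ¬f₂)
          (T-neither I (¬f₀ ∘ minimal⇒filled) (λ (x∈I , _) → x∉I ¬f₁ x∈I))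
        go (no ¬f₀) (yes f₁) _        = contradiction (filled-pred (ℕ.<⇒≤ k<α) f₁) ¬f₀
        go _        (no ¬f₁) (yes f₂) = contradiction (filled-pred k<α f₂) ¬f₁

      -- Evaluation of the two sums of the theorem.

      ∑-lower : ∀ {j s₁ sⱼ} → 0 < j → j < α i → At 1 s₁ → At j sⱼ →
        ∑∈ (λ u → s₁ ⊴? u ×-dec u ⊴? sⱼ) (λ u → + #[ s₁ , u ] * T u I)
          ≡ ∑ {j} (λ k → (1ℤ + 1ℤ * + toℕ k) * Δ² c (toℕ k))
      ∑-lower {suc j} {s₁} {sⱼ} _ j<α at₁ atⱼ = ∑∈-range 1 (suc j) (s≤s z≤n) j<α
        (λ u → s₁ ⊴? u ×-dec u ⊴? sⱼ)
        (between⇒inRange 1 j (s≤s z≤n) j<α at₁ atⱼ) (inRange⇒between 1 j (s≤s z≤n) j<α at₁ atⱼ)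
        (λ u → + #[ s₁ , u ] * T u I)
        (λ k → (1ℤ + 1ℤ * + k) * Δ² c k)
        (λ {k} k≤j at → let k<α = ℕ.≤-<-trans k≤j j<α in cong₂ _*_
          (trans (cong +_ (#interval 1 k (s≤s z≤n) k<α at₁ at))
            (cong (λ z → 1ℤ + z) (sym (ℤ.*-identityˡ (+ k)))))
          (T≡Δ²c k<α at))

      -- The element at index `j + 1 + k` has `m - k` inner elements weakly above it, `sᵦ` being at
      -- index `j + m`. The shift is written `l ℕ.+ j` so that successors of `l` come out by
      -- computation and the shifted `Δ²` is `Δ² c (k ℕ.+ j)`.
      ∑-upper : ∀ {j m sⱼ sᵦ} → 0 < j → suc (j ℕ.+ m) ≡ α i → At j sⱼ → At (j ℕ.+ m) sᵦ →
        ∑∈ (λ u → sⱼ ⊲? u ×-dec u ⊴? sᵦ) (λ u → + #[ u , sᵦ ] * T u I)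
          ≡ ∑ {m} (λ k → (+ m + -1ℤ * + toℕ k) * Δ² (λ l → c (l ℕ.+ j)) (toℕ k))
      ∑-upper {j} {m} {sⱼ} {sᵦ} 0<j 1+j+m≡α atⱼ atᵦ = ∑∈-range (suc j) m (s≤s z≤n) (ℕ.≤-reflexive 1+j+m≡α)
        (λ u → sⱼ ⊲? u ×-dec u ⊴? sᵦ)
        to from (λ u → + #[ u , sᵦ ] * T u I)
        (λ k → (+ m + -1ℤ * + k) * Δ² (λ l → c (l ℕ.+ j)) k)
        (λ {k} k<m at → cong₂ _*_ (weight k<m at)
          (T≡Δ²c (ℕ.≤-trans (s≤s (subst (_< j ℕ.+ m) (ℕ.+-comm j k) (ℕ.+-monoʳ-< j k<m)))
                       (ℕ.≤-reflexive 1+j+m≡α))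
            (at-cast (cong suc (ℕ.+-comm j k)) at)))
        where
        j+m<α : j ℕ.+ m < α i
        j+m<α = ℕ.≤-reflexive 1+j+m≡α

        to : ∀ {u} → sⱼ ⊲ u × u ⊴ sᵦ → InRange (suc j) m u
        to ((sⱼ⊴u , sⱼ≢u) , u⊴sᵦ) with between⇒inRange j m 0<j j+m<α atⱼ atᵦ (sⱼ⊴u , u⊴sᵦ)
        -- Offset 0 from `j` is `sⱼ` itself, which strictness excludes; the other offsets drop by
        -- one because the range starts at `suc j`.
        ... | zero  , _       , at = contradiction (at-unique atⱼ (at-cast (ℕ.+-identityʳ j) at)) sⱼ≢u
        ... | suc k , s≤s k<m , at = k , k<m , at-cast (ℕ.+-suc j k) at

        from : ∀ {u} → InRange (suc j) m u → sⱼ ⊲ u × u ⊴ sᵦ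
        from (k , k<m , at)
          with sⱼ⊴u , u⊴sᵦ ← inRange⇒between j m 0<j j+m<α atⱼ atᵦ
                 (suc k , s≤s k<m , at-cast (sym (ℕ.+-suc j k)) at) =
          (sⱼ⊴u , λ { refl → ℕ.m≢1+m+n j (at-index atⱼ at) }) , u⊴sᵦ

        weight : ∀ {k u} → k < m → At (suc j ℕ.+ k) u → + #[ u , sᵦ ] ≡ + m + -1ℤ * + k
        weight {k} k<m at with N , refl ← ℕ.m≤n⇒∃[o]m+o≡n k<m =
          trans (cong +_ (#interval (suc j ℕ.+ k) N (s≤s z≤n) (subst (_< α i) index j+m<α) at
                   (at-cast index atᵦ)))
            (remaining (+ k) (+ N))
          where
          index : j ℕ.+ (suc k ℕ.+ N) ≡ suc j ℕ.+ k ℕ.+ N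
          index = trans (ℕ.+-suc j (k ℕ.+ N)) (cong suc (sym (ℕ.+-assoc j k N)))
          remaining : ∀ k N → 1ℤ + N ≡ (1ℤ + (k + N)) + -1ℤ * k
          remaining = solve-∀

      -- Here `A - j` is `1 + m`. The coefficients of `c₁` and `cₘ` vanish, those of `cⱼ₊₁` are
      -- `-(1 + m) * j` and `j * (m + 1)` and cancel, and `cⱼ` receives `(1 + m) * (1 + j) - j * m`,
      -- which is `A`.
      combine : ∀ {A χⱼ χₚ χᵥ z Σ₁ Σ₂} (j m c₀ c₁ cⱼ cⱼ₊₁ cₘ cₐ : ℤ) → A ≡ 1ℤ + (j + m) →
        χⱼ ≡ cⱼ → χₚ ≡ cₐ → χᵥ ≡ c₀ - z →
        Σ₁ ≡ 1ℤ * c₀ - (1ℤ - 1ℤ) * c₁ + (1ℤ + 1ℤ * (j - 1ℤ)) * cⱼ₊₁ - (1ℤ + 1ℤ * j) * cⱼ →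
        Σ₂ ≡ m * cⱼ - (m - -1ℤ) * cⱼ₊₁ + (m + -1ℤ * (m - 1ℤ)) * cₐ - (m + -1ℤ * m) * cₘ →
        A * χⱼ - j * χₚ - (A - j) * χᵥ ≡ z * (A - j) - (A - j) * Σ₁ - j * Σ₂
      combine {z = z} j m c₀ c₁ cⱼ cⱼ₊₁ cₘ cₐ refl refl refl refl refl refl =
        solve (z ∷ j ∷ m ∷ c₀ ∷ c₁ ∷ cⱼ ∷ cⱼ₊₁ ∷ cₘ ∷ cₐ ∷ [])

      segment-identity : ∀ {j s₁ sⱼ sᵦ} → 1 ≤ j → j ≤ β i → IsS i 1 s₁ → IsS i j sⱼ → IsS i (β i) sᵦ →
        + α i * χ̂ sⱼ I - + j * χ̂? (peak i) I - (+ α i - + j) * χ̂? (valley i) I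
        ≡ 𝟏 (¬? (hasValley? i)) * (+ α i - + j)
        - (+ α i - + j) * ∑∈ (λ u → s₁ ⊴? u ×-dec u ⊴? sⱼ) (λ u → + #[ s₁ , u ] * T u I)
        - + j * ∑∈ (λ u → sⱼ ⊲? u ×-dec u ⊴? sᵦ) (λ u → + #[ u , sᵦ ] * T u I)
      segment-identity {j} 1≤j j≤β is₁ isⱼ isᵦ
        -- `m` counts the inner elements above `sⱼ`, so `α i` is `1 + j + m`.
        with m , j+m≡β ← ℕ.m≤n⇒∃[o]m+o≡n j≤β
           | _ , at₁ ← isS⇒at is₁ | j<α , atⱼ ← isS⇒at isⱼ | _ , atᵦ ← isS⇒at isᵦ =
        combine (+ j) (+ m) (c 0) (c 1) (c j) (c (suc j)) (c (m ℕ.+ j)) (c (suc (m ℕ.+ j)))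
          (cong +_ (sym 1+j+m≡α)) (sym (c≡χ̂ atⱼ))
          (trans c-peak (cong c (trans (sym 1+j+m≡α) (cong suc (ℕ.+-comm j m))))) c-valley
          (trans (∑-lower 1≤j j<α at₁ atⱼ) (∑-affine-Δ² 1ℤ 1ℤ j c))
          (trans (∑-upper 1≤j 1+j+m≡α atⱼ (at-cast (sym j+m≡β) atᵦ))
            (∑-affine-Δ² (+ m) -1ℤ m (λ l → c (l ℕ.+ j))))
        where
        1+j+m≡α : suc (j ℕ.+ m) ≡ α i
        1+j+m≡α = trans (cong suc j+m≡β) β≡

-- Positions and neighbours in the fence.

partialSum-step : ∀ {t} (α : Vector ℕ t) i →
  partialSum α (Fin.suc i) ≡ partialSum α (Fin.inject₁ i) ℕ.+ α i
partialSum-step {suc t} α Fin.zero    = ℕ.+-identityʳ (α Fin.zero)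
partialSum-step {suc t} α (Fin.suc i) = trans
  (cong (α Fin.zero ℕ.+_) (partialSum-step (α ∘ Fin.suc) i)) (sym (ℕ.+-assoc (α Fin.zero) _ _))

module _ {r : ℕ} {α : Vector ℕ (2 ℕ.+ r)} (1≤α : ∀ k → 1 ≤ α k)
         (2≤head : 2 ≤ head α) (2≤last : 2 ≤ last α) where
  open Fence α

  aₗ<aᵣ : ∀ i → aₗ i < aᵣ i
  aₗ<aᵣ i = ℕ.<-≤-trans (ℕ.m<m+n (aₗ i) (1≤α i)) (ℕ.≤-reflexive (sym (partialSum-step α i)))

  aᵣ≤aₗ : ∀ {i i′} → i Fin.< i′ → aᵣ i ≤ aₗ i′
  aᵣ≤aₗ {i} {i′} i<i′ = partialSum-mono α {Fin.suc i} {Fin.inject₁ i′}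
    (subst (suc (toℕ i) ≤_) (sym (Fin.toℕ-inject₁ i′)) i<i′)

  -- Guarantees that every shared element has a neighbour on its left.
  2≤aᵣ : ∀ i → 2 ≤ aᵣ i
  2≤aᵣ i = ℕ.≤-trans 2≤head (ℕ.m≤m+n _ _)

  total : ℕ
  total = a (Fin.fromℕ (2 ℕ.+ r))

  aᵣ≤total : ∀ i → aᵣ i ≤ total
  aᵣ≤total i = partialSum-mono α {Fin.suc i} {Fin.fromℕ (2 ℕ.+ r)}
    (subst (toℕ (Fin.suc i) ≤_) (sym (Fin.toℕ-fromℕ (2 ℕ.+ r))) (Fin.toℕ<n i))

  -- Since `n` is `total - 1`, this leaves a position to the right of the last shared element.
  2+aₗlast≤total : 2 ℕ.+ aₗ (Fin.fromℕ (suc r)) ≤ total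
  2+aₗlast≤total = subst₂ _≤_ (ℕ.+-comm _ 2) (sym (partialSum-step α (Fin.fromℕ (suc r))))
    (ℕ.+-monoʳ-≤ (aₗ (Fin.fromℕ (suc r))) 2≤last)

  suc-n : suc n ≡ total
  suc-n = ℕ.m+[n∸m]≡n (ℕ.≤-trans (s≤s z≤n) 2+aₗlast≤total)

  pos<total : ∀ x → pos x < total
  pos<total x = ℕ.≤-trans (s≤s (Fin.toℕ<n x)) (ℕ.≤-reflexive suc-n)

  element : ∀ {p} → 0 < p → p < total → ∃ λ x → pos x ≡ p
  element {suc p} _ p<total = Fin.fromℕ< p<n , cong suc (Fin.toℕ-fromℕ< p<n)
    where
    p<n : p < n
    p<n = ℕ.≤-pred (subst (suc (suc p) ≤_) (sym suc-n) p<total)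

  pos-injective : ∀ {x y} → pos x ≡ pos y → x ≡ y
  pos-injective eq = Fin.toℕ-injective (ℕ.suc-injective eq)

  opposite-parity : ∀ m → parity (suc m) ≡ parity m ℙ.⁻¹
  opposite-parity m = sym (ℙ.⁻¹-selfInverse (ℙ.suc-homo-⁻¹ m))

  ⋖-cases : ∀ {x y} → x ⋖ y →
    Step Odd (pos x) × pos y ≡ suc (pos x) ⊎ Step Even (pos y) × pos x ≡ suc (pos y)
  ⋖-cases (up i o l r eq)   = inj₁ ((i , o , l , r) , eq)
  ⋖-cases (down i e l r eq) = inj₂ ((i , e , l , r) , eq)

  odd⇒prev-even : ∀ {i′ i : Fin (2 ℕ.+ r)} → toℕ i ≡ suc (toℕ i′) → Odd i → Even i′
  odd⇒prev-even {i′} eq odd = ℙ.⁻¹-injective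
    (trans (sym (opposite-parity (suc (toℕ i′)))) (trans (cong (parity ∘ suc) (sym eq)) odd))

  even⇒prev-odd : ∀ {i′ i : Fin (2 ℕ.+ r)} → toℕ i ≡ suc (toℕ i′) → Even i → Odd i′
  even⇒prev-odd {i′} eq even = ℙ.⁻¹-injective
    (trans (sym (opposite-parity (suc (toℕ i′)))) (trans (cong (parity ∘ suc) (sym eq)) even))

  odd⇒next-even : ∀ {i i′ : Fin (2 ℕ.+ r)} → toℕ i′ ≡ suc (toℕ i) → Odd i → Even i′
  odd⇒next-even {i} eq odd = trans (cong (parity ∘ suc) eq) (trans (opposite-parity (suc (toℕ i))) (cong ℙ._⁻¹ odd))

  even⇒next-odd : ∀ {i i′ : Fin (2 ℕ.+ r)} → toℕ i′ ≡ suc (toℕ i) → Even i → Odd i′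
  even⇒next-odd {i} eq even = trans (cong (parity ∘ suc) eq) (trans (opposite-parity (suc (toℕ i))) (cong ℙ._⁻¹ even))

  -- The direction flips at a shared element: to the left of an odd segment the fence descends into
  -- `x`, to the left of an even one it ascends.
  record LeftNeighbour (i : Fin (2 ℕ.+ r)) (x : Fin n) : Set where
    field
      shared   : Shared x
      left     : Fin n
      pos-left : pos x ≡ suc (pos left)
      descends : Odd i → Step Even (pos left)
      ascends  : Even i → Step Odd (pos left)

  leftNeighbour : ∀ i {x} → pos x ≡ aₗ i → LeftNeighbour i x
  -- The first segment needs no clause: its `aₗ` is 0, while positions start at 1.
  leftNeighbour (Fin.suc i) {x} eq
    with y , pos-y ← element {toℕ x}
           (ℕ.≤-pred (subst (2 ≤_) (sym eq) (2≤aᵣ (Fin.inject₁ i)))) (ℕ.<⇒≤ (pos<total x)) = record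
    { shared   = i′ , s≤s (subst (_< suc r) (sym (Fin.toℕ-inject₁ i)) (Fin.toℕ<n i)) , eq
    ; left     = y
    ; pos-left = cong suc (sym pos-y)
    ; descends = λ odd → i′ , odd⇒prev-even adjacent odd , lower , upper
    ; ascends  = λ even → i′ , even⇒prev-odd adjacent even , lower , upper
    }
    where
    i′ = Fin.inject₁ i
    adjacent : toℕ (Fin.suc i) ≡ suc (toℕ i′)
    adjacent = cong suc (sym (Fin.toℕ-inject₁ i))
    lower : aₗ i′ ≤ pos y
    lower = subst (aₗ i′ ≤_) (sym pos-y) (ℕ.≤-pred (subst (aₗ i′ <_) (sym eq) (aₗ<aᵣ i′)))
    upper : pos y < aᵣ i′
    upper = ℕ.≤-reflexive (trans (cong suc pos-y) eq)

  record RightNeighbour (i : Fin (2 ℕ.+ r)) (x : Fin n) : Set where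
    field
      shared    : Shared x
      right     : Fin n
      pos-right : pos right ≡ suc (pos x)
      descends  : Odd i → Step Even (pos x)
      ascends   : Even i → Step Odd (pos x)

  rightNeighbour : ∀ i {x} → pos x ≡ aᵣ i → RightNeighbour i x
  rightNeighbour i {x} eq with ℕ.m≤n⇒m<n∨m≡n (Fin.toℕ<n i)
  -- The right end of the last segment is `total`, beyond every position.
  ... | inj₂ last = contradiction
    (trans eq (cong a (Fin.toℕ-injective (trans last (sym (Fin.toℕ-fromℕ _))))))
    (ℕ.<⇒≢ (pos<total x))
  ... | inj₁ i+1<t = record
    { shared    = i , i+1<t , eq
    ; right     = proj₁ next
    ; pos-right = proj₂ next
    ; descends  = λ odd → i′ , odd⇒next-even adjacent odd , lower , upper
    ; ascends   = λ even → i′ , even⇒next-odd adjacent even , lower , upper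
    }
    where
    i′ = Fin.fromℕ< i+1<t
    adjacent : toℕ i′ ≡ suc (toℕ i)
    adjacent = Fin.toℕ-fromℕ< i+1<t
    x≤aₗlast : pos x ≤ aₗ (Fin.fromℕ (suc r))
    x≤aₗlast = subst (_≤ aₗ (Fin.fromℕ (suc r))) (sym eq) (aᵣ≤aₗ {i} {Fin.fromℕ (suc r)}
      (subst (toℕ i <_) (sym (Fin.toℕ-fromℕ (suc r))) (ℕ.≤-pred i+1<t)))
    next : ∃ λ y → pos y ≡ suc (pos x)
    next = element (s≤s z≤n) (ℕ.≤-trans (s≤s (s≤s x≤aₗlast)) 2+aₗlast≤total)
    x≡aₗ : pos x ≡ aₗ i′
    x≡aₗ = trans eq (cong a (Fin.toℕ-injective (sym (trans (Fin.toℕ-inject₁ i′) adjacent))))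
    lower : aₗ i′ ≤ pos x
    lower = ℕ.≤-reflexive (sym x≡aₗ)
    upper : pos x < aᵣ i′
    upper = subst (_< aᵣ i′) (sym x≡aₗ) (aₗ<aᵣ i′)

  nonshared : ∀ {i x} → aₗ i < pos x → pos x < aᵣ i → ¬ Shared x
  nonshared {i} {x} l r (i′ , _ , eq) with Fin.<-cmp i′ i
  ... | tri< i′<i _ _ = ℕ.<⇒≱ l (subst (_≤ aₗ i) (sym eq) (aᵣ≤aₗ i′<i))
  ... | tri≈ _ refl _ = ℕ.<⇒≢ r eq
  ... | tri> _ _ i<i′ = ℕ.<⇒≱ r (subst (aᵣ i ≤_) (sym eq)
    (partialSum-mono α {Fin.suc i} {Fin.suc i′} (s≤s (ℕ.<⇒≤ i<i′))))

  sides-distinct : ∀ {x y z} → pos x ≡ suc (pos y) → pos z ≡ suc (pos x) → y ≢ z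
  sides-distinct y<x x<z refl = ℕ.m≢1+m+n _ (trans x<z (cong suc (trans y<x (sym (ℕ.+-comm _ 1)))))

  -- Coordinates on ascending and descending segments.

  module _ {i : Fin (2 ℕ.+ r)} (2≤αᵢ : 2 ≤ α i) where

    aᵣ≡ : aᵣ i ≡ aₗ i ℕ.+ α i
    aᵣ≡ = partialSum-step α i

    -- In an odd segment order follows position, so the index is the offset from the left end. Index
    -- 0 of the first segment and index `α i` of the last are vacant automatically, being positions
    -- 0 and `total`.
    ascending : Odd i → Coordinate i
    ascending odd = record
      { At              = At
      ; At?             = λ k x → pos x ℕ.≟ aₗ i ℕ.+ k
      ; at-unique       = λ p q → pos-injective (trans p (sym q))
      ; at-index        = λ p q → ℕ.+-cancelˡ-≡ (aₗ i) _ _ (trans (sym p) q)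
      ; ∈S⇒at           = ∈S⇒at
      ; at⇒∈S           = λ {k} k≤α p → subst (aₗ i ≤_) (sym p) (ℕ.m≤m+n (aₗ i) k) ,
                            subst₂ _≤_ (sym p) (sym aᵣ≡) (ℕ.+-monoʳ-≤ (aₗ i) k≤α)
      ; inner-exists    = inner-exists
      ; inner-nonshared = λ {k} 0<k k<α p → nonshared {i}
                            (subst (aₗ i <_) (sym p) (ℕ.m<m+n (aₗ i) 0<k))
                            (subst₂ _<_ (sym p) (sym aᵣ≡) (ℕ.+-monoʳ-< (aₗ i) k<α))
      ; at-valley       = at-valley
      ; at-peak         = at-peak
      ; cover           = cover
      ; below           = below
      ; above           = above
      }
      where
      At : ℕ → Pred (Fin n) 0ℓ
      At k x = pos x ≡ aₗ i ℕ.+ k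

      step-even⊥ : ∀ {k x} → k < α i → At k x → ¬ Step Even (pos x)
      step-even⊥ {k} k<α at = odd-even-⊥ (i , odd , subst (aₗ i ≤_) (sym at) (ℕ.m≤m+n (aₗ i) k) ,
        subst₂ _<_ (sym at) (sym aᵣ≡) (ℕ.+-monoʳ-< (aₗ i) k<α))

      next : ∀ {k x y} → At k x → pos y ≡ suc (pos x) → At (suc k) y
      next {k} at eq = trans eq (trans (cong suc at) (sym (ℕ.+-suc (aₗ i) k)))

      prev : ∀ {k x y} → At (suc k) y → pos y ≡ suc (pos x) → At k x
      prev {k} at eq = ℕ.suc-injective (trans (sym eq) (trans at (ℕ.+-suc (aₗ i) k)))

      consecutive : ∀ {k x y} → At k x → At (suc k) y → pos y ≡ suc (pos x)
      consecutive {k} at-x at-y = trans at-y (trans (ℕ.+-suc (aₗ i) k) (cong suc (sym at-x)))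

      at-left : ∀ {x} → At 0 x → pos x ≡ aₗ i
      at-left at = trans at (ℕ.+-identityʳ (aₗ i))

      at-right : ∀ {k x} → k ≡ α i → At k x → pos x ≡ aᵣ i
      at-right refl at = trans at (sym aᵣ≡)

      ∈S⇒at : ∀ {x} → x ∈S i → ∃ λ k → k ≤ α i × At k x
      ∈S⇒at (l , u) with k , eq ← ℕ.m≤n⇒∃[o]m+o≡n l =
        k , ℕ.+-cancelˡ-≤ (aₗ i) k (α i) (subst₂ _≤_ (sym eq) aᵣ≡ u) , sym eq

      inner-exists : ∀ {k} → 0 < k → k < α i → ∃ (At k)
      inner-exists {k} 0<k k<α = element (ℕ.<-≤-trans 0<k (ℕ.m≤n+m k (aₗ i)))
        (ℕ.<-≤-trans (ℕ.+-monoʳ-< (aₗ i) k<α) (subst (_≤ total) aᵣ≡ (aᵣ≤total i)))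

      cover : ∀ {k x y} → k < α i → At k x → At (suc k) y → x ⋖ y
      cover {k} k<α at-x at-y = up i odd (subst (aₗ i ≤_) (sym at-x) (ℕ.m≤m+n (aₗ i) k))
        (subst₂ _<_ (sym at-x) (sym aᵣ≡) (ℕ.+-monoʳ-< (aₗ i) k<α)) (consecutive at-x at-y)

      below : ∀ {k x w} → k < α i → At k x → w ⋖ x → ∃ λ k′ → k ≡ suc k′ × At k′ w
      below {k} k<α at w⋖x with ⋖-cases w⋖x
      below {k}     k<α at w⋖x | inj₂ (even-step , _) = contradiction even-step (step-even⊥ k<α at)
      below {suc k} k<α at w⋖x | inj₁ (_ , eq)        = k , refl , prev at eq
      -- At the valley the step on the left descends, whereas this cover would make it ascend.
      below {zero}  k<α at w⋖x | inj₁ (odd-step , eq) = ⊥-elim (odd-even-⊥ odd-step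
        (subst (Step Even) (ℕ.suc-injective (trans (sym pos-left) eq)) (descends odd)))
        where open LeftNeighbour (leftNeighbour i (at-left at))

      above : ∀ {k x w} → 0 < k → k ≤ α i → At k x → x ⋖ w → k < α i × At (suc k) w
      above {suc k} 0<k k≤α at x⋖w with ⋖-cases x⋖w
      ... | inj₂ (even-step , eq) = contradiction even-step (step-even⊥ k≤α (prev at eq))
      ... | inj₁ (odd-step , eq) with ℕ.m≤n⇒m<n∨m≡n k≤α
      ...   | inj₁ k<α = k<α , next at eq
      -- At the peak the step on the right descends, whereas this cover would make it ascend.
      ...   | inj₂ k≡α = ⊥-elim (odd-even-⊥ odd-step (descends odd))
        where open RightNeighbour (rightNeighbour i (at-right k≡α at))

      at-valley : ∀ {x} → At 0 x → IsValley x
      at-valley at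
        with y , at-y ← inner-exists (s≤s z≤n) 2≤αᵢ
        with i′ , even , l , u ← LeftNeighbour.descends (leftNeighbour i (at-left at)) odd =
        shared , left , y , sides-distinct pos-left (consecutive at at-y) ,
        down i′ even l u pos-left , cover (ℕ.<⇒≤ 2≤αᵢ) at at-y
        where open LeftNeighbour (leftNeighbour i (at-left at))

      at-peak : ∀ {x} → At (α i) x → IsPeak x
      at-peak at
        -- Writing `α i` as `2 + m` makes index `1 + m`, just below the peak, a positive one and
        -- hence occupied by an inner element.
        with m , 2+m≡α ← ℕ.m≤n⇒∃[o]m+o≡n 2≤αᵢ
        with at′ ← subst (λ k → At k _) (sym 2+m≡α) at
        with y , at-y ← inner-exists (s≤s z≤n) (ℕ.≤-reflexive 2+m≡α)
        with i′ , even , l , u ← RightNeighbour.descends (rightNeighbour i (at-right refl at)) odd =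
        shared , y , right , sides-distinct (consecutive at-y at′) pos-right ,
        cover (ℕ.≤-reflexive 2+m≡α) at-y at′ , down i′ even l u pos-right
        where open RightNeighbour (rightNeighbour i (at-right refl at))

    -- In an even segment order reverses position, so the index is the distance from the right end,
    -- stated additively to avoid truncated subtraction.
    descending : Even i → Coordinate i
    descending even = record
      { At              = At
      ; At?             = λ k x → pos x ℕ.+ k ℕ.≟ aᵣ i
      ; at-unique       = λ {k} p q → pos-injective (ℕ.+-cancelʳ-≡ k _ _ (trans p (sym q)))
      ; at-index        = λ {x = x} p q → ℕ.+-cancelˡ-≡ (pos x) _ _ (trans p (sym q))
      ; ∈S⇒at           = ∈S⇒at
      ; at⇒∈S           = λ {k} k≤α p → aₗ≤pos k≤α p , ℕ.m+n≤o⇒m≤o _ (ℕ.≤-reflexive p)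
      ; inner-exists    = inner-exists
      ; inner-nonshared = λ {k} 0<k k<α p → nonshared {i} (aₗ<pos k<α p) (pos<aᵣ 0<k p)
      ; at-valley       = at-valley
      ; at-peak         = at-peak
      ; cover           = cover
      ; below           = below
      ; above           = above
      }
      where
      At : ℕ → Pred (Fin n) 0ℓ
      At k x = pos x ℕ.+ k ≡ aᵣ i

      aₗ≤pos : ∀ {k x} → k ≤ α i → At k x → aₗ i ≤ pos x
      aₗ≤pos {k} {x} k≤α at = ℕ.+-cancelʳ-≤ k (aₗ i) (pos x)
        (ℕ.≤-trans (ℕ.+-monoʳ-≤ (aₗ i) k≤α) (ℕ.≤-reflexive (trans (sym aᵣ≡) (sym at))))

      aₗ<pos : ∀ {k x} → k < α i → At k x → aₗ i < pos x
      aₗ<pos {k} {x} k<α at = ℕ.+-cancelʳ-< k (aₗ i) (pos x)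
        (ℕ.<-≤-trans (ℕ.+-monoʳ-< (aₗ i) k<α) (ℕ.≤-reflexive (trans (sym aᵣ≡) (sym at))))

      pos<aᵣ : ∀ {k x} → 0 < k → At k x → pos x < aᵣ i
      pos<aᵣ {k} {x} 0<k at = subst (pos x <_) at (ℕ.m<m+n (pos x) 0<k)

      step-odd⊥ : ∀ {k x} → k < α i → At (suc k) x → ¬ Step Odd (pos x)
      step-odd⊥ k<α at odd-step =
        odd-even-⊥ odd-step (i , even , aₗ≤pos k<α at , pos<aᵣ (s≤s z≤n) at)

      next : ∀ {k x y} → At k x → pos x ≡ suc (pos y) → At (suc k) y
      next {k} at eq = trans (ℕ.+-suc _ k) (trans (cong (ℕ._+ k) (sym eq)) at)

      prev : ∀ {k x y} → At (suc k) y → pos x ≡ suc (pos y) → At k x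
      prev {k} at eq = trans (cong (ℕ._+ k) eq) (trans (sym (ℕ.+-suc _ k)) at)

      consecutive : ∀ {k x y} → At k x → At (suc k) y → pos x ≡ suc (pos y)
      consecutive {k} {x} {y} at-x at-y = ℕ.+-cancelʳ-≡ k (pos x) (suc (pos y))
        (trans at-x (trans (sym at-y) (ℕ.+-suc (pos y) k)))

      at-left : ∀ {k x} → k ≡ α i → At k x → pos x ≡ aₗ i
      at-left {k} {x} refl at = ℕ.+-cancelʳ-≡ k (pos x) (aₗ i) (trans at aᵣ≡)

      at-right : ∀ {x} → At 0 x → pos x ≡ aᵣ i
      at-right at = trans (sym (ℕ.+-identityʳ _)) at

      ∈S⇒at : ∀ {x} → x ∈S i → ∃ λ k → k ≤ α i × At k x
      ∈S⇒at {x} (l , u) with k , eq ← ℕ.m≤n⇒∃[o]m+o≡n u =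
        k , ℕ.+-cancelˡ-≤ (aₗ i) k (α i) (ℕ.≤-trans (ℕ.+-monoˡ-≤ k l) (ℕ.≤-reflexive (trans eq aᵣ≡))) , eq

      inner-exists : ∀ {k} → 0 < k → k < α i → ∃ (At k)
      -- Distance `k` from the right end is offset `l = α i - k` from the left end.
      inner-exists {k} 0<k k<α with l , k+l≡α ← ℕ.m≤n⇒∃[o]m+o≡n (ℕ.<⇒≤ k<α) =
        let x , eq = element {aₗ i ℕ.+ l} (ℕ.<-≤-trans 0<l (ℕ.m≤n+m l (aₗ i)))
                       (ℕ.<-≤-trans below-aᵣ (aᵣ≤total i))
        in x , trans (cong (ℕ._+ k) eq) p+k≡aᵣ
        where
        0<l : 0 < l
        0<l = ℕ.+-cancelˡ-< k 0 l (subst₂ _<_ (sym (ℕ.+-identityʳ k)) (sym k+l≡α) k<α)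
        p+k≡aᵣ : aₗ i ℕ.+ l ℕ.+ k ≡ aᵣ i
        p+k≡aᵣ = trans (ℕ.+-assoc (aₗ i) l k)
          (trans (cong (aₗ i ℕ.+_) (trans (ℕ.+-comm l k) k+l≡α)) (sym aᵣ≡))
        below-aᵣ : aₗ i ℕ.+ l < aᵣ i
        below-aᵣ = subst (aₗ i ℕ.+ l <_) p+k≡aᵣ (ℕ.m<m+n _ 0<k)

      cover : ∀ {k x y} → k < α i → At k x → At (suc k) y → x ⋖ y
      cover k<α at-x at-y = down i even (aₗ≤pos k<α at-y)
        (pos<aᵣ (s≤s z≤n) at-y) (consecutive at-x at-y)

      below : ∀ {k x w} → k < α i → At k x → w ⋖ x → ∃ λ k′ → k ≡ suc k′ × At k′ w
      below {k} k<α at w⋖x with ⋖-cases w⋖x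
      below {k}     k<α at w⋖x | inj₁ (odd-step , eq)  = contradiction odd-step (step-odd⊥ k<α (next at eq))
      below {suc k} k<α at w⋖x | inj₂ (_ , eq)         = k , refl , prev at eq
      below {zero}  k<α at w⋖x | inj₂ (even-step , eq) = ⊥-elim (odd-even-⊥ (ascends even) even-step)
        where open RightNeighbour (rightNeighbour i (at-right at))

      above : ∀ {k x w} → 0 < k → k ≤ α i → At k x → x ⋖ w → k < α i × At (suc k) w
      above {suc k} 0<k k≤α at x⋖w with ⋖-cases x⋖w
      ... | inj₁ (odd-step , eq) = contradiction odd-step (step-odd⊥ k≤α at)
      ... | inj₂ (even-step , eq) with ℕ.m≤n⇒m<n∨m≡n k≤α
      ...   | inj₁ k<α = k<α , next at eq
      ...   | inj₂ k≡α = ⊥-elim (odd-even-⊥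
        (subst (Step Odd) (ℕ.suc-injective (trans (sym pos-left) eq)) (ascends even)) even-step)
        where open LeftNeighbour (leftNeighbour i (at-left k≡α at))

      at-valley : ∀ {x} → At 0 x → IsValley x
      at-valley at
        with y , at-y ← inner-exists (s≤s z≤n) 2≤αᵢ
        with i′ , odd , l , u ← RightNeighbour.ascends (rightNeighbour i (at-right at)) even =
        shared , y , right , sides-distinct (consecutive at at-y) pos-right ,
        cover (ℕ.<⇒≤ 2≤αᵢ) at at-y , up i′ odd l u pos-right
        where open RightNeighbour (rightNeighbour i (at-right at))

      at-peak : ∀ {x} → At (α i) x → IsPeak x
      at-peak at
        with m , 2+m≡α ← ℕ.m≤n⇒∃[o]m+o≡n 2≤αᵢ
        with at′ ← subst (λ k → At k _) (sym 2+m≡α) at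
        with y , at-y ← inner-exists (s≤s z≤n) (ℕ.≤-reflexive 2+m≡α)
        with i′ , odd , l , u ← LeftNeighbour.ascends (leftNeighbour i (at-left refl at)) even =
        shared , left , y , sides-distinct pos-left (consecutive at-y at′) ,
        up i′ odd l u pos-left , cover (ℕ.≤-reflexive 2+m≡α) at-y at′
        where open LeftNeighbour (leftNeighbour i (at-left refl at))

    coordinate : Coordinate i
    coordinate with parity (suc (toℕ i)) in eq
    ... | 0ℙ = descending eq
    ... | 1ℙ = ascending eq

theorem4p1 : (r : ℕ) (let t = 2 ℕ.+ r) (α : Vector ℕ t) (let open Fence α) →
    (∀ k → 1 ≤ α k) → 2 ≤ head α → 2 ≤ last α →
    (i : Fin t) → 2 ≤ α i →
    (j : ℕ) → 1 ≤ j → j ≤ β i →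
    (s₁ sⱼ sᵦ : Fin n) → IsS i 1 s₁ → IsS i j sⱼ → IsS i (β i) sᵦ →
    (I : 𝒥) →
    + α i * χ̂ sⱼ I - + j * χ̂? (peak i) I - (+ α i - + j) * χ̂? (valley i) I
    ≡ 𝟏 (¬? (hasValley? i)) * (+ α i - + j)
    - (+ α i - + j) * ∑∈ (λ u → s₁ ⊴? u ×-dec u ⊴? sⱼ) (λ u → + #[ s₁ , u ] * T u I)
    - + j * ∑∈ (λ u → sⱼ ⊲? u ×-dec u ⊴? sᵦ) (λ u → + #[ u , sᵦ ] * T u I)
theorem4p1 r α 1≤α 2≤head 2≤last i 2≤αᵢ j 1≤j j≤β s₁ sⱼ sᵦ is₁ isⱼ isᵦ I =
  segment-identity (coordinate 1≤α 2≤head 2≤last 2≤αᵢ) (ℕ.<⇒≤ 2≤αᵢ) I 1≤j j≤β is₁ isⱼ isᵦ
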